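{- For every odd integer $n\ge 5$, $\lambda_{2,n}(1)=1$ and $\lambda_{2,n}(2)=3$.
   Context: For an odd integer $n>1$, a representation of a positive integer $k$ (with respect to $2$ and $n$) is an expression $k=\sum_{j\ge 0}\varepsilon_j(2)2^j+\sum_{j\ge 0}\varepsilon_j(n)n^j$ with only finitely many nonzero coefficients, where $\varepsilon_j(2)\in\{0,\pm1\}$ and $\varepsilon_j(n)\in\{0,\pm1,\dots,\pm\lfloor n/2\rfloor\}$ are integers. Its length is $\sum_{j\ge 0}(|\varepsilon_j(2)|+|\varepsilon_j(n)|)$. For a positive integer $h$, $\lambda_{2,n}(h)$ denotes the smallest positive integer that has a representation of length $h$ but no representation of length less than $h$. -}

module Defs where

open import Data.Fin.Base using (toℕ)
open import Data.Integer.Base using (ℤ; 0ℤ; +_; ∣_∣)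
import Data.Integer.Base as ℤ
import Data.Integer.Properties as ℤ
open import Data.Nat.Base using (ℕ; _+_; _/_; _^_; _≤_; _<_)
import Data.Nat.Properties as ℕ
open import Data.Product.Base using (Σ-syntax; _×_)
open import Relation.Binary.PropositionalEquality.Core using (_≡_)
open import Relation.Nullary.Negation.Core using (¬_)

open import Algebra.Properties.Monoid.Sum ℤ.+-0-monoid
  using () renaming (sum to sumℤ)
open import Algebra.Properties.Monoid.Sum ℕ.+-0-monoid
  using () renaming (sum to sumℕ)

-- A sequence of signed digits ε₀, ε₁, …, finitely many of them nonzero,
-- each of absolute value at most d, to be read in base b.  The field
-- `size` only witnesses finiteness: it need not be the least such bound,
-- and neither `value` nor `weight` depends on its choice.
record Expansion (b d : ℕ) : Set where
  field
    digit    : ℕ → ℤ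
    bounded  : ∀ j → ∣ digit j ∣ ≤ d
    size     : ℕ
    vanishes : ∀ j → size ≤ j → digit j ≡ 0ℤ

  value : ℤ
  value = sumℤ {size} (λ j → digit (toℕ j) ℤ.* + (b ^ toℕ j))

  weight : ℕ
  weight = sumℕ {size} (λ j → ∣ digit (toℕ j) ∣)

record Representation (n k : ℕ) : Set where
  field
    base2 : Expansion 2 1
    baseN : Expansion n (n / 2)

  open Expansion

  field
    represents : + k ≡ value base2 ℤ.+ value baseN

  length : ℕ
  length = weight base2 + weight baseN

HasRepresentationOfLength : (n k h : ℕ) → Set
HasRepresentationOfLength n k h =
  Σ[ r ∈ Representation n k ] Representation.length r ≡ h

HasShortestLength : (n k h : ℕ) → Set
HasShortestLength n k h =
  HasRepresentationOfLength n k h ×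
  (∀ l → l < h → ¬ HasRepresentationOfLength n k l)

IsLeastPositive : (ℕ → Set) → ℕ → Set
IsLeastPositive P m = (0 < m × P m) × (∀ k → 0 < k → P k → m ≤ k)

-- λ₂,ₙ(h) = m.  This is a relation because λ₂,ₙ(h) is only defined once
-- some positive integer has shortest length h.
λ₂[_,_]≡_ : (n h m : ℕ) → Set
λ₂[ n , h ]≡ m = IsLeastPositive (λ k → HasShortestLength n k h) m

{-# OPTIONS --safe #-}
-- A representation of length 0 has value 0, and one of length 1 has value
-- ±2ʲ or ±nʲ.  Since 3 is neither a power of 2 nor a power of n ≥ 5,
-- 3 = 1 + 2 needs two terms, whereas 1 and 2 are powers of 2.
module Submission where

open import Defs
open import Data.Fin.Base using (Fin; zero; suc; toℕ)
open import Data.Integer.Base using (ℤ; 0ℤ; 1ℤ; +_; ∣_∣)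
import Data.Integer.Base as ℤ
import Data.Integer.Properties as ℤ
open import Data.Nat.Base using (ℕ; zero; suc; _+_; _*_; _^_; _≤_; _<_; z≤n; s≤s; z<s; s<s)
open import Data.Nat.Divisibility using (_∤_; _∣?_; m∣m*n; ∣⇒≤)
import Data.Nat.Properties as ℕ
open import Data.Product.Base using (_×_; _,_; ∃-syntax)
open import Data.Sum.Base using (_⊎_; inj₁; inj₂)
open import Relation.Binary.PropositionalEquality
open import Relation.Nullary.Decidable.Core using (from-no)
open import Relation.Nullary.Negation.Core using (¬_; contradiction)

open import Algebra.Properties.Monoid.Sum ℤ.+-0-monoid
  using () renaming (sum to sumℤ)
open import Algebra.Properties.Monoid.Sum ℕ.+-0-monoid
  using () renaming (sum to sumℕ)

m+n≡1⇒ : ∀ m {n} → m + n ≡ 1 → (m ≡ 0 × n ≡ 1) ⊎ (m ≡ 1 × n ≡ 0)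
m+n≡1⇒ zero          eq = inj₁ (refl , eq)
m+n≡1⇒ (suc zero)    eq = inj₂ (refl , ℕ.suc-injective eq)
m+n≡1⇒ (suc (suc m)) ()

i≡0⇒i+j≡j : ∀ {i} j → i ≡ 0ℤ → i ℤ.+ j ≡ j
i≡0⇒i+j≡j j refl = ℤ.+-identityˡ j

j≡0⇒i+j≡i : ∀ i {j} → j ≡ 0ℤ → i ℤ.+ j ≡ i
j≡0⇒i+j≡i i refl = ℤ.+-identityʳ i

∣i∣≡0⇒i*j≡0 : ∀ i j → ∣ i ∣ ≡ 0 → i ℤ.* j ≡ 0ℤ
∣i∣≡0⇒i*j≡0 i j ∣i∣≡0 =
  trans (cong (ℤ._* j) (ℤ.∣i∣≡0⇒i≡0 {i} ∣i∣≡0)) (ℤ.*-zeroˡ j)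

∣i∣≡1⇒∣i*j∣≡∣j∣ : ∀ i j → ∣ i ∣ ≡ 1 → ∣ i ℤ.* j ∣ ≡ ∣ j ∣
∣i∣≡1⇒∣i*j∣≡∣j∣ i j ∣i∣≡1 = begin
  ∣ i ℤ.* j ∣    ≡⟨ ℤ.abs-* i j ⟩
  ∣ i ∣ * ∣ j ∣  ≡⟨ cong (_* ∣ j ∣) ∣i∣≡1 ⟩
  1 * ∣ j ∣      ≡⟨ ℕ.*-identityˡ ∣ j ∣ ⟩
  ∣ j ∣          ∎
  where open ≡-Reasoning

-- The weights `w` are arbitrary because the induction passes to the tail, where powers `b ^ toℕ i`
-- turn into `b ^ suc (toℕ i)`; a statement about powers alone would not be inductive.
weightedSum-0 : ∀ {m} (f w : Fin m → ℤ) →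
                sumℕ (λ i → ∣ f i ∣) ≡ 0 → sumℤ (λ i → f i ℤ.* w i) ≡ 0ℤ
weightedSum-0 {zero}  f w eq = refl
weightedSum-0 {suc m} f w eq = cong₂ ℤ._+_
  (∣i∣≡0⇒i*j≡0 (f zero) (w zero) (ℕ.m+n≡0⇒m≡0 ∣ f zero ∣ eq))
  (weightedSum-0 (λ i → f (suc i)) (λ i → w (suc i)) (ℕ.m+n≡0⇒n≡0 ∣ f zero ∣ eq))

-- Naturals adding up to 1 consist of a single 1 and zeros elsewhere, so only one term survives,
-- with coefficient 1 or -1. The absolute value absorbs that sign.
weightedSum-1 : ∀ {m} (f w : Fin m → ℤ) → sumℕ (λ i → ∣ f i ∣) ≡ 1 →
                ∃[ j ] ∣ sumℤ (λ i → f i ℤ.* w i) ∣ ≡ ∣ w j ∣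
weightedSum-1 {suc m} f w eq with m+n≡1⇒ ∣ f zero ∣ eq
... | inj₁ (head≡0 , tail≡1) =
  let j , ∣tailSum∣≡∣wⱼ∣ = weightedSum-1 (λ i → f (suc i)) (λ i → w (suc i)) tail≡1
  in  suc j , trans
        (cong ∣_∣ (i≡0⇒i+j≡j (sumℤ (λ i → f (suc i) ℤ.* w (suc i)))
                             (∣i∣≡0⇒i*j≡0 (f zero) (w zero) head≡0)))
        ∣tailSum∣≡∣wⱼ∣
... | inj₂ (head≡1 , tail≡0) = zero , trans
  (cong ∣_∣ (j≡0⇒i+j≡i (f zero ℤ.* w zero)
                       (weightedSum-0 (λ i → f (suc i)) (λ i → w (suc i)) tail≡0)))
  (∣i∣≡1⇒∣i*j∣≡∣j∣ (f zero) (w zero) head≡1)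

module _ {b d} (e : Expansion b d) where
  open Expansion e

  weight≡0⇒value≡0 : weight ≡ 0 → value ≡ 0ℤ
  weight≡0⇒value≡0 = weightedSum-0 {size} (λ i → digit (toℕ i)) (λ i → + (b ^ toℕ i))

  weight≡1⇒∣value∣-power : weight ≡ 1 → ∃[ j ] ∣ value ∣ ≡ b ^ j
  weight≡1⇒∣value∣-power eq =
    let i , p = weightedSum-1 {size} (λ i → digit (toℕ i)) (λ i → + (b ^ toℕ i)) eq
    in  toℕ i , p

length-0⇒≡0 : ∀ {n k} → HasRepresentationOfLength n k 0 → k ≡ 0
length-0⇒≡0 (r , eq) = ℤ.+-injective (trans represents (cong₂ ℤ._+_
  (weight≡0⇒value≡0 base2 (ℕ.m+n≡0⇒m≡0 _ eq))
  (weight≡0⇒value≡0 baseN (ℕ.m+n≡0⇒n≡0 (Expansion.weight base2) eq))))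
  where open Representation r

-- The one unit of length falls in one of the two bases, and the other expansion then has weight and
-- value 0.
length-1⇒power : ∀ {n k} → HasRepresentationOfLength n k 1 →
                 (∃[ j ] k ≡ 2 ^ j) ⊎ (∃[ j ] k ≡ n ^ j)
length-1⇒power (r , eq) with m+n≡1⇒ (Expansion.weight (Representation.base2 r)) eq
... | inj₁ (w₂≡0 , wₙ≡1) =
  let j , ∣v∣≡n^j = weight≡1⇒∣value∣-power baseN wₙ≡1
      k≡v = trans represents (i≡0⇒i+j≡j (value baseN) (weight≡0⇒value≡0 base2 w₂≡0))
  -- Since `∣ + k ∣` computes to `k`, taking absolute values discards the sign of the digit and
  -- keeps `k`.
  in  inj₂ (j , trans (cong ∣_∣ k≡v) ∣v∣≡n^j)
  where open Representation r; open Expansion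
... | inj₂ (w₂≡1 , wₙ≡0) =
  let j , ∣v∣≡2^j = weight≡1⇒∣value∣-power base2 w₂≡1
      k≡v = trans represents (j≡0⇒i+j≡i (value base2) (weight≡0⇒value≡0 baseN wₙ≡0))
  in  inj₁ (j , trans (cong ∣_∣ k≡v) ∣v∣≡2^j)
  where open Representation r; open Expansion

-- The exponent 0 gives 1, which is too small; any positive exponent gives a multiple of `b`.
1<m∧b∤m⇒m≢b^j : ∀ {b m} → 1 < m → b ∤ m → ∀ j → m ≢ b ^ j
1<m∧b∤m⇒m≢b^j 1<m b∤m zero    refl = ℕ.<-irrefl refl 1<m
1<m∧b∤m⇒m≢b^j {b} 1<m b∤m (suc j) refl = b∤m (m∣m*n (b ^ j))

3-not-length-1 : ∀ {n} → 5 ≤ n → ¬ HasRepresentationOfLength n 3 1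
3-not-length-1 5≤n rep with length-1⇒power rep
... | inj₁ (j , 3≡2^j) = 1<m∧b∤m⇒m≢b^j (s<s z<s) (from-no (2 ∣? 3)) j 3≡2^j
... | inj₂ (j , 3≡n^j) = 1<m∧b∤m⇒m≢b^j (s<s z<s) n∤3 j 3≡n^j
  where
  n∤3 : _ ∤ 3
  -- A divisor of 3 is at most 3, so it cannot be at least 5.
  n∤3 n∣3 = contradiction (ℕ.≤-trans 5≤n (∣⇒≤ n∣3)) λ { (s≤s (s≤s (s≤s ()))) }

-- With `size` 0 both sums are empty and reduce to zero even for a variable base, so the
-- representations below are checked by `refl` for arbitrary `n`.
zeroExpansion : ∀ {b d} → Expansion b d
zeroExpansion = record
  { digit    = λ _ → 0ℤ
  ; bounded  = λ _ → z≤n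
  ; size     = 0
  ; vanishes = λ _ _ → refl
  }

twoDigits : ∀ {b d} (ε₀ ε₁ : ℤ) → ∣ ε₀ ∣ ≤ d → ∣ ε₁ ∣ ≤ d → Expansion b d
twoDigits {d = d} ε₀ ε₁ ∣ε₀∣≤d ∣ε₁∣≤d = record
  { digit    = digit
  ; bounded  = bounded
  ; size     = 2
  ; vanishes = λ { _ (s≤s (s≤s _)) → refl }
  }
  where
  digit : ℕ → ℤ
  digit 0             = ε₀
  digit 1             = ε₁
  digit (suc (suc _)) = 0ℤ

  bounded : ∀ j → ∣ digit j ∣ ≤ d
  bounded 0             = ∣ε₀∣≤d
  bounded 1             = ∣ε₁∣≤d
  bounded (suc (suc _)) = z≤n

1-length-1 : ∀ {n} → HasRepresentationOfLength n 1 1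
1-length-1 = record
  { base2      = twoDigits 1ℤ 0ℤ ℕ.≤-refl z≤n
  ; baseN      = zeroExpansion
  ; represents = refl
  } , refl

2-length-1 : ∀ {n} → HasRepresentationOfLength n 2 1
2-length-1 = record
  { base2      = twoDigits 0ℤ 1ℤ z≤n ℕ.≤-refl
  ; baseN      = zeroExpansion
  ; represents = refl
  } , refl

3-length-2 : ∀ {n} → HasRepresentationOfLength n 3 2
3-length-2 = record
  { base2      = twoDigits 1ℤ 1ℤ ℕ.≤-refl ℕ.≤-refl
  ; baseN      = zeroExpansion
  ; represents = refl
  } , refl

proposition3 : ∀ (n : ℕ) → 5 ≤ n → 2 ∤ n → (λ₂[ n , 1 ]≡ 1) × (λ₂[ n , 2 ]≡ 3)
proposition3 n 5≤n _ =
  -- Minimality of 1 is immediate: `1 ≤ k` and `0 < k` are the same type.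
  ((z<s , 1-length-1 , 1-shortest) , λ _ 0<k _ → 0<k) ,
  ((z<s , 3-length-2 , 3-shortest) , 3-least)
  where
  1-shortest : ∀ l → l < 1 → ¬ HasRepresentationOfLength n 1 l
  1-shortest zero    _        rep = contradiction (length-0⇒≡0 rep) λ ()
  1-shortest (suc _) (s≤s ()) _

  3-shortest : ∀ l → l < 2 → ¬ HasRepresentationOfLength n 3 l
  3-shortest 0 _ rep = contradiction (length-0⇒≡0 rep) λ ()
  3-shortest 1 _ rep = 3-not-length-1 5≤n rep
  3-shortest (suc (suc _)) (s≤s (s≤s ())) _

  3-least : ∀ k → 0 < k → HasShortestLength n k 2 → 3 ≤ k
  -- Both 1 and 2 are powers of 2, so they already have length 1, which is below 2.
  3-least 1 _ (_ , shortest) = contradiction 1-length-1 (shortest 1 ℕ.≤-refl)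
  3-least 2 _ (_ , shortest) = contradiction 2-length-1 (shortest 1 ℕ.≤-refl)
  3-least (suc (suc (suc _))) _ _ = s≤s (s≤s (s≤s z≤n))
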